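{- For every integer $n\ge 3$, let $t(n)$ denote the largest positive integer $k$ such that there exists a positive tribonacci sequence of length $k$ terminating at $n$. Then there are at most $561001$ positive tribonacci sequences of length $t(n)$ terminating at $n$.
   Context: A tribonacci sequence of length $k$ is a sequence of integers $\langle a_i\rangle_{i=1}^k$ such that $a_i=a_{i-1}+a_{i-2}+a_{i-3}$ for all $4\le i\le k$. It terminates at $a_k$. It is positive if $a_1,a_2,a_3>0$ (for length less than 3, all terms are required to be positive). For $n\ge 3$ the set of such $k$ is non-empty and bounded, so $t(n)$ is well defined. -}

module Defs where

open import Data.Fin using (Fin; toℕ)
open import Data.Integer as ℤ using (ℤ; 0ℤ)
open import Data.List using (List; length)
open import Data.List.Relation.Unary.All using (All)
open import Data.List.Relation.Unary.Unique.Propositional using (Unique)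
open import Data.Nat using (ℕ; suc; _+_; _≤_; _<_)
open import Data.Product using (∃-syntax; _×_)
open import Data.Vec using (Vec; lookup)
open import Relation.Binary.PropositionalEquality using (_≡_)

-- A sequence ⟨aᵢ⟩ with 1 ≤ i ≤ k is a vector of length k; the term aᵢ sits at
-- the 0-based position i - 1.

IsTribonacci : ∀ {k} → Vec ℤ k → Set
IsTribonacci {k} a =
  ∀ (p q r s : Fin k) →
  toℕ q ≡ 1 + toℕ p → toℕ r ≡ 2 + toℕ p → toℕ s ≡ 3 + toℕ p →
  lookup a s ≡ lookup a r ℤ.+ lookup a q ℤ.+ lookup a p

-- For k < 3 this says that all terms are positive.
IsPositive : ∀ {k} → Vec ℤ k → Set
IsPositive {k} a = ∀ (i : Fin k) → toℕ i < 3 → 0ℤ ℤ.< lookup a i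

-- The empty sequence terminates at no integer, so k is positive here.
TerminatesAt : ∀ {k} → ℤ → Vec ℤ k → Set
TerminatesAt {k} n a = ∃[ i ] suc (toℕ i) ≡ k × lookup a i ≡ n

record PositiveTribonacci (n : ℤ) (k : ℕ) (a : Vec ℤ k) : Set where
  field
    tribonacci : IsTribonacci a
    positive   : IsPositive a
    terminates : TerminatesAt n a

-- The relation k = t(n).
record IsLargestLength (n : ℤ) (k : ℕ) : Set where
  field
    attained : ∃[ a ] PositiveTribonacci n k a
    maximal  : ∀ j → (∃[ a ] PositiveTribonacci n j a) → j ≤ k

-- P holds of at most N elements of A: pairwise distinct elements satisfying P
-- never number more than N.
AtMost : ∀ {A : Set} → ℕ → (A → Set) → Set
AtMost {A} N P = ∀ (xs : List A) → Unique xs → All P xs → length xs ≤ N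

{-# OPTIONS --safe #-}
-- Write k = m + 4; the last term is n = b x + (a + b) y + c z in the first three
-- terms, with tribonacci numbers a, b, c.  If a solution has z > x + y, prepending
-- z − x − y gives a longer sequence, so for k = t(n) no lattice point of this plane
-- lies in the part of the positive triangle where z > x + y.  Running the recurrence
-- backwards from k shows that the lattice of differences of solutions has a basis of
-- vectors of size B with B² ≤ 4 b.  Hence n < 54 b B, since otherwise some lattice
-- point near the multiple of (1 , 1 , 3) in the plane would lie there, and then all
-- y and z are below 54 B.  By Cramer's rule the terms at k − 1 and k − 3, which determine the
-- sequence together with n, each vary by at most 432 < 749, and 749² = 561001.
module Submission where

open import Defs
open import Data.Integer using (ℤ; +_; _≤_)
open import Data.Nat using (ℕ)

open import Data.Empty using (⊥; ⊥-elim)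
open import Data.Fin as Fin using (Fin; toℕ; fromℕ; combine)
import Data.Fin.Properties as Fin
open import Data.Integer using (_+_; _*_; _-_; -_; _<_; ∣_∣; 0ℤ; 1ℤ; -1ℤ; +[1+_]; -[1+_];
  -≤+; +≤+; +<+; _%ℕ_; _/ℕ_; _⊖_; positive; nonNegative)
open import Data.Integer.DivMod using (a≡a%ℕn+[a/ℕn]*n; n%ℕd<d)
import Data.Integer.Properties as ℤ
open import Algebra.Properties.AbelianGroup ℤ.+-0-abelianGroup using () renaming (∙-cancelˡ to +-cancelˡ)
open import Data.Integer.Tactic.RingSolver using (solve-∀)
import Data.Nat.Tactic.RingSolver as ℕ-Solver
open import Data.List as List using (List; _∷_)
open import Data.List.Membership.Propositional.Properties using (∈-lookup)
import Data.List.Relation.Unary.All as All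
open import Data.List.Relation.Unary.AllPairs using (_∷_)
open import Data.List.Relation.Unary.Unique.Propositional using (Unique)
open import Data.Nat as ℕ using (zero; suc; z≤n; s≤s)
import Data.Nat.Properties as ℕ
open import Data.Product using (∃-syntax; _×_; _,_; proj₁; proj₂)
open import Data.Sum using (inj₁; inj₂)
open import Data.Vec using (Vec; _∷_; lookup; tabulate)
open import Data.Vec.Properties using (lookup∘tabulate; tabulate∘lookup; tabulate-cong)
open import Relation.Binary.PropositionalEquality
open import Relation.Nullary using (yes; no)

-- Ordered-ring facts about ℤ

+-nonNeg : ∀ {i j} → 0ℤ ≤ i → 0ℤ ≤ j → 0ℤ ≤ i + j
+-nonNeg = ℤ.+-mono-≤

*-nonNeg : ∀ {i j} → 0ℤ ≤ i → 0ℤ ≤ j → 0ℤ ≤ i * j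
*-nonNeg {+ m} {+ n} _ _ = subst (0ℤ ≤_) (ℤ.pos-* m n) (+≤+ z≤n)

*-pos : ∀ {i j} → 0ℤ < i → 0ℤ < j → 0ℤ < i * j
*-pos {+[1+ m ]} {+[1+ n ]} _ _ = +<+ (s≤s z≤n)
*-pos {+ zero} (+<+ ()) _
*-pos {+[1+ _ ]} {+ zero} _ (+<+ ())

sq-nonNeg : ∀ i → 0ℤ ≤ i * i
sq-nonNeg (+ n)    = *-nonNeg {+ n} {+ n} (+≤+ z≤n) (+≤+ z≤n)
sq-nonNeg -[1+ n ] = +≤+ z≤n

≤-by-difference : ∀ {i j e} → j - i ≡ e → 0ℤ ≤ e → i ≤ j
≤-by-difference eq 0≤e = ℤ.0≤i-j⇒j≤i (subst (0ℤ ≤_) (sym eq) 0≤e)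

≤-cancelˡ : ∀ {k i j} → 0ℤ < k → k * i ≤ k * j → i ≤ j
≤-cancelˡ {k} {i} {j} 0<k = ℤ.*-cancelˡ-≤-pos i j k {{positive 0<k}}

<-cancelˡ : ∀ {k i j} → 0ℤ < k → k * i < k * j → i < j
<-cancelˡ {k} 0<k = ℤ.*-cancelˡ-<-nonNeg k {{nonNegative (ℤ.<⇒≤ 0<k)}}

i≤+∣i∣ : ∀ i → i ≤ + ∣ i ∣
i≤+∣i∣ (+ n)    = ℤ.≤-refl
i≤+∣i∣ -[1+ n ] = -≤+

∣i∣*∣i∣≡i*i : ∀ i → + ∣ i ∣ * + ∣ i ∣ ≡ i * i
∣i∣*∣i∣≡i*i (+ n)    = refl
∣i∣*∣i∣≡i*i -[1+ n ] = refl

∣i-j∣≤bound : ∀ {i j M} → 0ℤ < i → i < + M → 0ℤ < j → j < + M → ∣ i - j ∣ ℕ.≤ M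
∣i-j∣≤bound {+ m} {+ n} {M} _ (+<+ m<M) _ (+<+ n<M) = begin
  ∣ + m - + n ∣  ≡⟨ cong ∣_∣ (ℤ.m-n≡m⊖n m n) ⟩
  ∣ m ⊖ n ∣      ≤⟨ ℤ.∣m⊝n∣≤m⊔n m n ⟩
  m ℕ.⊔ n        ≤⟨ ℕ.⊔-lub (ℕ.<⇒≤ m<M) (ℕ.<⇒≤ n<M) ⟩
  M              ∎
  where open ℕ.≤-Reasoning

floorDivision : ∀ {K} → 0ℤ < K → ∀ i →
  ∃[ f ] ∃[ s ] i ≡ f + s * K × 0ℤ ≤ f × f < K
floorDivision {+[1+ k ]} _ i =
  + (i %ℕ suc k) , i /ℕ suc k , a≡a%ℕn+[a/ℕn]*n i (suc k) , +≤+ z≤n , +<+ (n%ℕd<d i (suc k))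
floorDivision {+ zero} (+<+ ())

residue-injective : ∀ d .{{_ : ℕ.NonZero d}} {i j} →
  i %ℕ d ≡ j %ℕ d → ∣ i - j ∣ ℕ.< d → i ≡ j
residue-injective d {i} {j} eq ∣i-j∣<d = ℤ.i-j≡0⇒i≡j i j (begin
  i - j   ≡⟨ difference ⟩
  t * + d ≡⟨ cong (_* + d) t≡0 ⟩
  0ℤ * + d ≡⟨ ℤ.*-zeroˡ (+ d) ⟩
  0ℤ      ∎)
  where
  open ≡-Reasoning
  t = i /ℕ d - j /ℕ d
  difference : i - j ≡ t * + d
  difference = begin
    i - j
      ≡⟨ cong₂ _-_ (a≡a%ℕn+[a/ℕn]*n i d) (a≡a%ℕn+[a/ℕn]*n j d) ⟩
    (+ (i %ℕ d) + (i /ℕ d) * + d) - (+ (j %ℕ d) + (j /ℕ d) * + d)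
      ≡⟨ cong (λ e → (+ e + (i /ℕ d) * + d) - (+ (j %ℕ d) + (j /ℕ d) * + d)) eq ⟩
    (+ (j %ℕ d) + (i /ℕ d) * + d) - (+ (j %ℕ d) + (j /ℕ d) * + d)
      ≡⟨ cancel (+ (j %ℕ d)) (i /ℕ d) (j /ℕ d) (+ d) ⟩
    t * + d ∎
    where
    cancel : ∀ r u v w → (r + u * w) - (r + v * w) ≡ (u - v) * w
    cancel = solve-∀
  ∣t∣*d<d : ∣ t ∣ ℕ.* d ℕ.< 1 ℕ.* d
  ∣t∣*d<d = subst₂ ℕ._<_ (trans (cong ∣_∣ difference) (ℤ.abs-* t (+ d))) (sym (ℕ.*-identityˡ d)) ∣i-j∣<d
  t≡0 : t ≡ 0ℤ
  t≡0 = ℤ.∣i∣≡0⇒i≡0 (ℕ.n<1⇒n≡0 (ℕ.*-cancelʳ-< d ∣ t ∣ 1 ∣t∣*d<d))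

-- Tribonacci sequences as functions of their first three terms

trib : ℤ → ℤ → ℤ → ℕ → ℤ
trib x y z zero    = x
trib x y z (suc i) = trib y z (z + y + x) i

trib-rec : ∀ x y z i → trib x y z (3 ℕ.+ i) ≡ trib x y z (2 ℕ.+ i) + trib x y z (1 ℕ.+ i) + trib x y z i
trib-rec x y z zero    = refl
trib-rec x y z (suc i) = trib-rec y z (z + y + x) i

-- The recurrence can be run backwards: each earlier term is a difference of later ones, so three
-- consecutive equal terms propagate down to the start.
trib-determined : ∀ i {x y z x′ y′ z′} →
  trib x y z i ≡ trib x′ y′ z′ i →
  trib x y z (1 ℕ.+ i) ≡ trib x′ y′ z′ (1 ℕ.+ i) →
  trib x y z (2 ℕ.+ i) ≡ trib x′ y′ z′ (2 ℕ.+ i) →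
  x ≡ x′ × y ≡ y′ × z ≡ z′
trib-determined zero e₀ e₁ e₂ = e₀ , e₁ , e₂
trib-determined (suc i) {x} {y} {z} {x′} {y′} {z′} e₀ e₁ e₂
  with trib-determined i e₀ e₁ e₂
... | refl , refl , e = +-cancelˡ (z + y) x x′ e , refl , refl

lookup-trib : ∀ {j} x y z (v : Vec ℤ j) → IsTribonacci (x ∷ y ∷ z ∷ v) →
  ∀ i → lookup (x ∷ y ∷ z ∷ v) i ≡ trib x y z (toℕ i)
lookup-trib x y z v t Fin.zero = refl
lookup-trib x y z v t (Fin.suc Fin.zero) = refl
lookup-trib x y z v t (Fin.suc (Fin.suc Fin.zero)) = refl
lookup-trib x y z (w ∷ v) t (Fin.suc (Fin.suc (Fin.suc i)))
  -- The recurrence at position 0 identifies the fourth entry `w` with `z + y + x`, so the tail is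
  -- again an instance of the claim.
  with refl ← t Fin.zero (Fin.suc Fin.zero) (Fin.suc (Fin.suc Fin.zero))
                (Fin.suc (Fin.suc (Fin.suc Fin.zero))) refl refl refl =
  lookup-trib y z w v
    (λ p q r s e₁ e₂ e₃ → t (Fin.suc p) (Fin.suc q) (Fin.suc r) (Fin.suc s)
      (cong suc e₁) (cong suc e₂) (cong suc e₃))
    (Fin.suc (Fin.suc i))

tribVec : ∀ k → ℤ → ℤ → ℤ → Vec ℤ k
tribVec k x y z = tabulate (λ i → trib x y z (toℕ i))

lookup-tribVec : ∀ {k} x y z (i : Fin k) → lookup (tribVec k x y z) i ≡ trib x y z (toℕ i)
lookup-tribVec x y z = lookup∘tabulate (λ i → trib x y z (toℕ i))

tribVec-isTribonacci : ∀ k x y z → IsTribonacci (tribVec k x y z)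
tribVec-isTribonacci k x y z p q r s e₁ e₂ e₃
  rewrite lookup-tribVec x y z p | lookup-tribVec x y z q
        | lookup-tribVec x y z r | lookup-tribVec x y z s
        | e₁ | e₂ | e₃ = trib-rec x y z (toℕ p)

tribVec-positive : ∀ k {x y z} → 0ℤ < x → 0ℤ < y → 0ℤ < z → IsPositive (tribVec k x y z)
tribVec-positive k {x} {y} {z} 0<x 0<y 0<z i i<3 =
  subst (0ℤ <_) (sym (lookup-tribVec x y z i)) (first (toℕ i) i<3)
  where
  first : ∀ j → j ℕ.< 3 → 0ℤ < trib x y z j
  first 0 _ = 0<x
  first 1 _ = 0<y
  first 2 _ = 0<z
  first (suc (suc (suc _))) (s≤s (s≤s (s≤s ())))

tribVec-solution : ∀ j {x y z n} → 0ℤ < x → 0ℤ < y → 0ℤ < z → trib x y z j ≡ n →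
  PositiveTribonacci n (suc j) (tribVec (suc j) x y z)
tribVec-solution j {x} {y} {z} 0<x 0<y 0<z e = record
  { tribonacci = tribVec-isTribonacci (suc j) x y z
  ; positive   = tribVec-positive (suc j) 0<x 0<y 0<z
  ; terminates = fromℕ j , cong suc (Fin.toℕ-fromℕ j) ,
      trans (lookup-tribVec x y z (fromℕ j)) (trans (cong (trib x y z) (Fin.toℕ-fromℕ j)) e)
  }

-- Coefficients of the terms and the sequence run backwards

-- (a , b , c) is a window of the sequence 0, 1, 1, 2, 4, 7, … run forwards and
-- (p , q , r) one of 0, 1, −1, 0, 2, … run backwards; the rows (r , q , p) and
-- (p − q − r , r , q) span the integer points of b x + (a + b) y + c z = 0, and
-- a, b, c and p, q, r are up to sign the minors of one another.
record Window (m : ℕ) : Set where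
  field
    a b c p q r : ℤ
    a-minor : a ≡ p * p - p * q - q * q - q * r
    b-minor : b ≡ q * q - p * r
    c-minor : c ≡ r * r + q * q + q * r - p * q
    p-minor : p ≡ a * (a + b) - b * (c - b)
    q-minor : q ≡ b * b - a * c
    r-minor : r ≡ c * c - b * c - a * b - b * b
    0≤a     : 0ℤ ≤ a
    0<b     : 0ℤ < b
    a+b≤c   : a + b ≤ c
    c≤b+b   : c ≤ b + b
    -- The coefficients are those of `term₃` shifted back: the entries before `a` are `c - b - a`
    -- and `b + b - c`.
    term₀   : ∀ x y z → trib x y z m ≡ (b + b - c) * x + (a + a + b - c) * y + (c - a - b) * z
    term₁   : ∀ x y z → trib x y z (1 ℕ.+ m) ≡ (c - b - a) * x + (b - a) * y + a * z
    term₂   : ∀ x y z → trib x y z (2 ℕ.+ m) ≡ a * x + (c - b) * y + b * z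

  term₃ : ∀ x y z → trib x y z (3 ℕ.+ m) ≡ b * x + (a + b) * y + c * z
  term₃ x y z = begin
    trib x y z (3 ℕ.+ m)
      ≡⟨ trib-rec x y z m ⟩
    trib x y z (2 ℕ.+ m) + trib x y z (1 ℕ.+ m) + trib x y z m
      ≡⟨ cong₂ _+_ (cong₂ _+_ (term₂ x y z) (term₁ x y z)) (term₀ x y z) ⟩
    _
      ≡⟨ collect a b c x y z ⟩
    b * x + (a + b) * y + c * z ∎
    where
    open ≡-Reasoning
    collect : ∀ a b c x y z →
      a * x + (c - b) * y + b * z + ((c - b - a) * x + (b - a) * y + a * z)
        + ((b + b - c) * x + (a + a + b - c) * y + (c - a - b) * z)
      ≡ b * x + (a + b) * y + c * z
    collect = solve-∀

window : ∀ m → Window m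
window zero = record
  { a = 0ℤ ; b = 1ℤ ; c = 1ℤ ; p = 0ℤ ; q = 1ℤ ; r = -1ℤ
  ; a-minor = refl ; b-minor = refl ; c-minor = refl
  ; p-minor = refl ; q-minor = refl ; r-minor = refl
  ; 0≤a = ℤ.≤-refl ; 0<b = +<+ (s≤s z≤n) ; a+b≤c = ℤ.≤-refl ; c≤b+b = +≤+ (s≤s z≤n)
  ; term₀ = first ; term₁ = second ; term₂ = third
  }
  where
  first : ∀ x y z → x ≡ 1ℤ * x + 0ℤ * y + 0ℤ * z
  first = solve-∀
  second : ∀ x y z → y ≡ 0ℤ * x + 1ℤ * y + 0ℤ * z
  second = solve-∀
  third : ∀ x y z → z ≡ 0ℤ * x + 0ℤ * y + 1ℤ * z
  third = solve-∀
window (suc m) = record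
  { a = b ; b = c ; c = a + b + c ; p = q ; q = r ; r = p - q - r
  ; a-minor = trans b-minor (a-step p q r)
  ; b-minor = trans c-minor (b-step p q r)
  -- Shifting turns each minor identity into the next one; only the new third entries `a + b + c`
  -- and `p - q - r` need all three old identities.
  ; c-minor = trans (cong₂ _+_ (cong₂ _+_ a-minor b-minor) c-minor) (c-step p q r)
  ; p-minor = trans q-minor (p-step a b c)
  ; q-minor = trans r-minor (q-step a b c)
  ; r-minor = trans (cong₂ _-_ (cong₂ _-_ p-minor q-minor) r-minor) (r-step a b c)
  -- The inequalities feed one another: `0≤a` gives the next `a+b≤c`, which in turn gives the next
  -- `c≤b+b`.
  ; 0≤a = ℤ.<⇒≤ 0<b
  ; 0<b = ℤ.<-≤-trans (ℤ.+-mono-≤-< 0≤a 0<b) a+b≤c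
  ; a+b≤c = ≤-by-difference (excess a b c) 0≤a
  ; c≤b+b = ℤ.+-monoˡ-≤ c a+b≤c
  ; term₀ = λ x y z → trans (term₁ x y z) (term₀-step a b c x y z)
  ; term₁ = λ x y z → trans (term₂ x y z) (term₁-step a b c x y z)
  ; term₂ = λ x y z → trans (term₃ x y z) (term₂-step a b c x y z)
  }
  where
  open Window (window m)
  a-step : ∀ p q r → q * q - p * r ≡ q * q - q * r - r * r - r * (p - q - r)
  a-step = solve-∀
  b-step : ∀ p q r → r * r + q * q + q * r - p * q ≡ r * r - q * (p - q - r)
  b-step = solve-∀
  c-step : ∀ p q r →
    p * p - p * q - q * q - q * r + (q * q - p * r) + (r * r + q * q + q * r - p * q)
    ≡ (p - q - r) * (p - q - r) + r * r + r * (p - q - r) - q * r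
  c-step = solve-∀
  p-step : ∀ a b c → b * b - a * c ≡ b * (b + c) - c * (a + b + c - c)
  p-step = solve-∀
  q-step : ∀ a b c → c * c - b * c - a * b - b * b ≡ c * c - b * (a + b + c)
  q-step = solve-∀
  r-step : ∀ a b c →
    a * (a + b) - b * (c - b) - (b * b - a * c) - (c * c - b * c - a * b - b * b)
    ≡ (a + b + c) * (a + b + c) - c * (a + b + c) - b * c - c * c
  r-step = solve-∀
  excess : ∀ a b c → a + b + c - (b + c) ≡ a
  excess = solve-∀
  term₀-step : ∀ a b c x y z →
    (c - b - a) * x + (b - a) * y + a * z
    ≡ (c + c - (a + b + c)) * x + (b + b + c - (a + b + c)) * y + (a + b + c - b - c) * z
  term₀-step = solve-∀
  term₁-step : ∀ a b c x y z →
    a * x + (c - b) * y + b * z ≡ (a + b + c - c - b) * x + (c - b) * y + b * z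
  term₁-step = solve-∀
  term₂-step : ∀ a b c x y z →
    b * x + (a + b) * y + c * z ≡ b * x + (a + b + c - c) * y + c * z
  term₂-step = solve-∀

-- Size of the lattice basis

i<j⇒0<j-i : ∀ {i j} → i < j → 0ℤ < j - i
i<j⇒0<j-i {i} {j} i<j = subst (_< j - i) (ℤ.+-inverseʳ i) (ℤ.+-monoˡ-< (- i) i<j)

-- Completing the square in X bounds 4 u N from below by (4 u w − v²) Y².
quadraticForm-bound : ∀ u v w X Y {N k C} → N ≡ u * X * X + v * X * Y + w * Y * Y →
  0ℤ < k → k ≤ + 4 * u * w - v * v → + 4 * u * N ≡ k * C → Y * Y ≤ C
quadraticForm-bound u v w X Y {k = k} refl 0<k k≤D eq =
  ≤-cancelˡ 0<k (≤-by-difference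
    (trans (cong (_- k * (Y * Y)) (sym eq)) (square u v w k X Y))
    (+-nonNeg (sq-nonNeg (u * X + u * X + v * Y))
              (*-nonNeg (ℤ.i≤j⇒0≤j-i k≤D) (sq-nonNeg Y))))
  where
  square : ∀ u v w k X Y →
    + 4 * u * (u * X * X + v * X * Y + w * Y * Y) - k * (Y * Y)
    ≡ (u * X + u * X + v * Y) * (u * X + u * X + v * Y) + (+ 4 * u * w - v * v - k) * (Y * Y)
  square = solve-∀

combination-< : ∀ {K E f g u v} → 0ℤ ≤ f → f < K → 0ℤ ≤ g → g < K → 0ℤ < E → u ≤ E → v ≤ E →
  f * u + g * v < K * (E + E)
combination-< {K} {E} 0≤f f<K 0≤g g<K 0<E u≤E v≤E =
  subst (_ <_) (sym (ℤ.*-distribˡ-+ K E E)) (ℤ.+-mono-< (product 0≤f f<K u≤E) (product 0≤g g<K v≤E))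
  where
  product : ∀ {f u} → 0ℤ ≤ f → f < K → u ≤ E → f * u < K * E
  product {f} 0≤f f<K u≤E = ℤ.≤-<-trans
    (ℤ.*-monoˡ-≤-nonNeg f {{nonNegative 0≤f}} u≤E)
    (ℤ.*-monoʳ-<-pos E {{positive 0<E}} f<K)

module _ {m} (W : Window m) where
  open Window W

  b≤c : b ≤ c
  b≤c = ℤ.≤-trans (subst (_≤ a + b) (ℤ.+-identityˡ b) (ℤ.+-monoˡ-≤ b 0≤a)) a+b≤c

  0<c : 0ℤ < c
  0<c = ℤ.<-≤-trans 0<b b≤c

  -- The right side is minus the discriminant of the form with coefficients `b`, `a + b`, `c`. The
  -- excess over `c * c` is 2 c (2 b - c) + (c - (a + b)) (c + (a + b)), where the window
  -- inequalities make every factor non-negative.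
  c*c≤discriminant : c * c ≤ + 4 * c * b - (a + b) * (a + b)
  c*c≤discriminant = ≤-by-difference (split a b c)
    (+-nonNeg (*-nonNeg (+-nonNeg (ℤ.<⇒≤ 0<c) (ℤ.<⇒≤ 0<c)) (ℤ.i≤j⇒0≤j-i c≤b+b))
              (*-nonNeg (ℤ.i≤j⇒0≤j-i a+b≤c) (+-nonNeg (ℤ.<⇒≤ 0<c) (+-nonNeg 0≤a (ℤ.<⇒≤ 0<b)))))
    where
    split : ∀ a b c → + 4 * c * b - (a + b) * (a + b) - c * c
      ≡ (c + c) * (b + b - c) + (c - (a + b)) * (c + (a + b))
    split = solve-∀

  b*c≤c*c : b * c ≤ c * c
  b*c≤c*c = ℤ.*-monoʳ-≤-nonNeg c {{nonNegative (ℤ.<⇒≤ 0<c)}} b≤c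

  b*b≤b*c : b * b ≤ b * c
  b*b≤b*c = ℤ.*-monoˡ-≤-nonNeg b {{nonNegative (ℤ.<⇒≤ 0<b)}} b≤c

  -- The form takes the value b² at (q , p). In `eliminate` the letters `a`, `b`, `c` are free, so
  -- the minor identities can be substituted, leaving a polynomial identity in p, q, r.
  b*b-form : b * b ≡ b * q * q + (a + b) * q * p + c * p * p
  b*b-form = eliminate p q r a-minor b-minor c-minor
    where
    expand : ∀ p q r → (q * q - p * r) * (q * q - p * r) ≡
      (q * q - p * r) * q * q + ((p * p - p * q - q * q - q * r) + (q * q - p * r)) * q * p
        + (r * r + q * q + q * r - p * q) * p * p
    expand = solve-∀
    eliminate : ∀ p q r {a b c} →
      a ≡ p * p - p * q - q * q - q * r → b ≡ q * q - p * r → c ≡ r * r + q * q + q * r - p * q →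
      b * b ≡ b * q * q + (a + b) * q * p + c * p * p
    eliminate p q r refl refl refl = expand p q r

  c*b-form : c * b ≡ c * q * q + (a + b) * q * r + b * r * r
  c*b-form = eliminate p q r a-minor b-minor c-minor
    where
    expand : ∀ p q r → (r * r + q * q + q * r - p * q) * (q * q - p * r) ≡
      (r * r + q * q + q * r - p * q) * q * q
        + ((p * p - p * q - q * q - q * r) + (q * q - p * r)) * q * r + (q * q - p * r) * r * r
    expand = solve-∀
    eliminate : ∀ p q r {a b c} →
      a ≡ p * p - p * q - q * q - q * r → b ≡ q * q - p * r → c ≡ r * r + q * q + q * r - p * q →
      c * b ≡ c * q * q + (a + b) * q * r + b * r * r
    eliminate p q r refl refl refl = expand p q r

  -- The factor k is chosen so that 4 u N = k · 4 b. It is b² here, b c for `q²≤4b` and c² for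
  -- `r²≤4b`, and never exceeds c², hence never the discriminant bound.
  p²≤4b : p * p ≤ + 4 * b
  p²≤4b = quadraticForm-bound b (a + b) c q p b*b-form (*-pos 0<b 0<b)
    (ℤ.≤-trans b*b≤b*c (ℤ.≤-trans b*c≤c*c (subst (c * c ≤_) (swap a b c) c*c≤discriminant)))
    (scale b)
    where
    swap : ∀ a b c → + 4 * c * b - (a + b) * (a + b) ≡ + 4 * b * c - (a + b) * (a + b)
    swap = solve-∀
    scale : ∀ b → + 4 * b * (b * b) ≡ b * b * (+ 4 * b)
    scale = solve-∀

  q²≤4b : q * q ≤ + 4 * b
  q²≤4b = quadraticForm-bound c (a + b) b p q (trans b*b-form (reverse a b c p q)) (*-pos 0<b 0<c)
    (ℤ.≤-trans b*c≤c*c c*c≤discriminant)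
    (scale b c)
    where
    reverse : ∀ a b c p q → b * q * q + (a + b) * q * p + c * p * p
      ≡ c * p * p + (a + b) * p * q + b * q * q
    reverse = solve-∀
    scale : ∀ b c → + 4 * c * (b * b) ≡ b * c * (+ 4 * b)
    scale = solve-∀

  r²≤4b : r * r ≤ + 4 * b
  r²≤4b = quadraticForm-bound c (a + b) b q r c*b-form (*-pos 0<c 0<c) c*c≤discriminant (scale b c)
    where
    scale : ∀ b c → + 4 * c * (c * b) ≡ c * c * (+ 4 * b)
    scale = solve-∀

  record Bound (B : ℕ) : Set where
    field
      1≤B   : 1 ℕ.≤ B
      ∣p∣≤B : ∣ p ∣ ℕ.≤ B
      ∣q∣≤B : ∣ q ∣ ℕ.≤ B
      ∣r∣≤B : ∣ r ∣ ℕ.≤ B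
      B²≤4b : + B * + B ≤ + 4 * b

  bound : ∃[ B ] Bound B
  -- Including 1 makes the rounding error bound 3 B visibly positive, and its square is still at
  -- most 4 b.
  bound = 1 ℕ.⊔ (∣ p ∣ ℕ.⊔ (∣ q ∣ ℕ.⊔ ∣ r ∣)) , record
    { 1≤B   = ℕ.m≤m⊔n 1 (∣ p ∣ ℕ.⊔ (∣ q ∣ ℕ.⊔ ∣ r ∣))
    ; ∣p∣≤B = ℕ.m≤n⇒m≤o⊔n 1 (ℕ.m≤m⊔n ∣ p ∣ _)
    ; ∣q∣≤B = ℕ.m≤n⇒m≤o⊔n 1 (ℕ.m≤n⇒m≤o⊔n ∣ p ∣ (ℕ.m≤m⊔n ∣ q ∣ _))
    ; ∣r∣≤B = ℕ.m≤n⇒m≤o⊔n 1 (ℕ.m≤n⇒m≤o⊔n ∣ p ∣ (ℕ.m≤n⊔m ∣ q ∣ _))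
    ; B²≤4b = ⊔-square 1 (∣ p ∣ ℕ.⊔ (∣ q ∣ ℕ.⊔ ∣ r ∣)) 1≤4b 
        (⊔-square ∣ p ∣ (∣ q ∣ ℕ.⊔ ∣ r ∣) (abs p p²≤4b) 
          (⊔-square ∣ q ∣ ∣ r ∣ (abs q q²≤4b) (abs r r²≤4b)))
    }
    where
    ⊔-square : ∀ i j → + i * + i ≤ + 4 * b → + j * + j ≤ + 4 * b → + (i ℕ.⊔ j) * + (i ℕ.⊔ j) ≤ + 4 * b
    ⊔-square i j hi hj with ℕ.⊔-sel i j
    ... | inj₁ e rewrite e = hi
    ... | inj₂ e rewrite e = hj
    abs : ∀ i → i * i ≤ + 4 * b → + ∣ i ∣ * + ∣ i ∣ ≤ + 4 * b
    abs i = subst (_≤ + 4 * b) (sym (∣i∣*∣i∣≡i*i i))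
    1≤4b : + 1 * + 1 ≤ + 4 * b
    1≤4b = ℤ.i<j⇒suc[i]≤j (*-pos {+ 4} (+<+ (s≤s z≤n)) 0<b)

-- Rounding to the lattice of solutions

-- K times the rounded coordinate is b C - (f u + g v): the coordinate C / N of the target, scaled
-- by K, less the rounding error. That error stays below 2 K E.
remainder-positive : ∀ {b C N S T f g s t u v w E K} →
  K ≡ N * b → 0ℤ < K →
  b * (C - N * w) ≡ S * u + T * v → S ≡ f + s * K → T ≡ g + t * K →
  f * u + g * v < K * (E + E) → K * (E + E) ≤ b * C →
  0ℤ < w + s * u + t * v
remainder-positive {b} {C} {N} {f = f} {g} {s} {t} {u} {v} {w} {E} {K} refl 0<K spanned refl refl small large =
  <-cancelˡ 0<K (subst₂ _<_ (sym (ℤ.*-zeroʳ K)) scaled (i<j⇒0<j-i (ℤ.<-≤-trans small large)))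
  where
  open ≡-Reasoning
  regroup₁ : ∀ b C N w e → b * C - e ≡ b * (C - N * w) + N * b * w - e
  regroup₁ = solve-∀
  regroup₂ : ∀ K f g s t u v w →
    (f + s * K) * u + (g + t * K) * v + K * w - (f * u + g * v) ≡ K * (w + s * u + t * v)
  regroup₂ = solve-∀
  scaled : b * C - (f * u + g * v) ≡ K * (w + s * u + t * v)
  scaled = begin
    b * C - (f * u + g * v)
      ≡⟨ regroup₁ b C N w (f * u + g * v) ⟩
    b * (C - N * w) + K * w - (f * u + g * v)
      ≡⟨ cong (λ e → e + K * w - (f * u + g * v)) spanned ⟩
    (f + s * K) * u + (g + t * K) * v + K * w - (f * u + g * v)
      ≡⟨ regroup₂ K f g s t u v w ⟩
    K * (w + s * u + t * v) ∎

i≤3B : ∀ {B i j k} l → ∣ i ∣ ℕ.≤ B → ∣ j ∣ ℕ.≤ B → ∣ k ∣ ℕ.≤ B → ∣ l ∣ ℕ.≤ ∣ i ∣ ℕ.+ ∣ j ∣ ℕ.+ ∣ k ∣ →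
  l ≤ + (B ℕ.+ B ℕ.+ B)
i≤3B l i≤B j≤B k≤B l≤ = ℤ.≤-trans (i≤+∣i∣ l)
  (+≤+ (ℕ.≤-trans l≤ (ℕ.+-mono-≤ (ℕ.+-mono-≤ i≤B j≤B) k≤B)))

-- 54 B: the 9 comes from `N≤9b`, each basis coordinate is at most 3 B, and two basis vectors
-- contribute to the rounding error.
radius : ℕ → ℕ
radius B = 9 ℕ.* ((B ℕ.+ B ℕ.+ B) ℕ.+ (B ℕ.+ B ℕ.+ B))

-- The last term of a sequence of length m + 4 has index 3 + m, so index 4 + m stands for sequences
-- longer by exactly one.
Inextensible : ℕ → ℤ → Set
Inextensible m n = ∀ w x y → 0ℤ < w → 0ℤ < x → 0ℤ < y → trib w x y (4 ℕ.+ m) ≢ n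

module _ {m} (W : Window m) where
  open Window W

  -- The normal (b , a + b , c) is the cross product of (r , q , p) and (p - q - r , r , q), hence
  -- orthogonal to both; `plane′` treats the second row.
  plane : ∀ i → b * (i * r) + (a + b) * (i * q) + c * (i * p) ≡ 0ℤ
  plane i = eliminate p q r a-minor b-minor c-minor
    where
    vanish : ∀ p q r i → (q * q - p * r) * (i * r)
      + ((p * p - p * q - q * q - q * r) + (q * q - p * r)) * (i * q)
      + (r * r + q * q + q * r - p * q) * (i * p) ≡ 0ℤ
    vanish = solve-∀
    eliminate : ∀ p q r {a b c} →
      a ≡ p * p - p * q - q * q - q * r → b ≡ q * q - p * r → c ≡ r * r + q * q + q * r - p * q →
      b * (i * r) + (a + b) * (i * q) + c * (i * p) ≡ 0ℤ
    eliminate p q r refl refl refl = vanish p q r i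

  plane′ : ∀ i → b * (i * (p - q - r)) + (a + b) * (i * r) + c * (i * q) ≡ 0ℤ
  plane′ i = eliminate p q r a-minor b-minor c-minor
    where
    vanish : ∀ p q r i → (q * q - p * r) * (i * (p - q - r))
      + ((p * p - p * q - q * q - q * r) + (q * q - p * r)) * (i * r)
      + (r * r + q * q + q * r - p * q) * (i * q) ≡ 0ℤ
    vanish = solve-∀
    eliminate : ∀ p q r {a b c} →
      a ≡ p * p - p * q - q * q - q * r → b ≡ q * q - p * r → c ≡ r * r + q * q + q * r - p * q →
      b * (i * (p - q - r)) + (a + b) * (i * r) + c * (i * q) ≡ 0ℤ
    eliminate p q r refl refl refl = vanish p q r i

  -- Cramer's rule: the (y , z) parts of the two basis rows form a matrix of determinant q² - p r =
  -- b. For `span-x` the first coordinate then follows from the equation of the plane.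
  span-y : ∀ Y Z → b * Y ≡ (q * Y - r * Z) * q + (q * Z - p * Y) * r
  span-y Y Z = trans (cong (_* Y) b-minor) (expand p q r Y Z)
    where
    expand : ∀ p q r Y Z → (q * q - p * r) * Y ≡ (q * Y - r * Z) * q + (q * Z - p * Y) * r
    expand = solve-∀

  span-z : ∀ Y Z → b * Z ≡ (q * Y - r * Z) * p + (q * Z - p * Y) * q
  span-z Y Z = trans (cong (_* Z) b-minor) (expand p q r Y Z)
    where
    expand : ∀ p q r Y Z → (q * q - p * r) * Z ≡ (q * Y - r * Z) * p + (q * Z - p * Y) * q
    expand = solve-∀

  span-x : ∀ {X} Y Z → b * X + (a + b) * Y + c * Z ≡ 0ℤ →
    b * X ≡ (q * Y - r * Z) * r + (q * Z - p * Y) * (p - q - r)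
  span-x {X} Y Z on-plane = begin
    b * X
      ≡⟨ isolate a b c X Y Z ⟩
    b * X + (a + b) * Y + c * Z - ((a + b) * Y + c * Z)
      ≡⟨ cong₂ _-_ on-plane (cong₂ _+_ (cong (_* Y) (cong₂ _+_ a-minor b-minor)) (cong (_* Z) c-minor)) ⟩
    0ℤ - (((p * p - p * q - q * q - q * r) + (q * q - p * r)) * Y + (r * r + q * q + q * r - p * q) * Z)
      ≡⟨ expand p q r Y Z ⟩
    (q * Y - r * Z) * r + (q * Z - p * Y) * (p - q - r) ∎
    where
    open ≡-Reasoning
    isolate : ∀ a b c X Y Z → b * X ≡ b * X + (a + b) * Y + c * Z - ((a + b) * Y + c * Z)
    isolate = solve-∀
    expand : ∀ p q r Y Z →
      0ℤ - (((p * p - p * q - q * q - q * r) + (q * q - p * r)) * Y + (r * r + q * q + q * r - p * q) * Z)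
      ≡ (q * Y - r * Z) * r + (q * Z - p * Y) * (p - q - r)
    expand = solve-∀

  -- The value of b x + (a + b) y + c z at (1 , 1 , 3). There z - x - y is 1 as well, so at (1 , 1 ,
  -- 3) n / N the first two terms and the prepended one all equal n / N.
  N : ℤ
  N = b + (a + b) + + 3 * c

  0<N : 0ℤ < N
  0<N = ℤ.+-mono-< {0ℤ} {_} {0ℤ}
    (ℤ.+-mono-<-≤ {0ℤ} {_} {0ℤ} 0<b (+-nonNeg 0≤a (ℤ.<⇒≤ 0<b)))
    (*-pos {+ 3} (+<+ (s≤s z≤n)) (0<c W))

  N≤9b : N ≤ + 9 * b
  N≤9b = ≤-by-difference (split a b c)
    (+-nonNeg (ℤ.i≤j⇒0≤j-i a+b≤c) (*-nonNeg {+ 4} (+≤+ z≤n) (ℤ.i≤j⇒0≤j-i c≤b+b)))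
    where
    split : ∀ a b c → + 9 * b - (b + (a + b) + + 3 * c) ≡ (c - (a + b)) + + 4 * (b + b - c)
    split = solve-∀

  -- Rounding (1 , 1 , 3) n / N to the lattice of solutions gives one with z > x + y.
  extend : ∀ {E} x y z → 0ℤ < E → p ≤ E → q ≤ E → r ≤ E → p - q - r ≤ E → q + q - p ≤ E →
    N * (E + E) ≤ trib x y z (3 ℕ.+ m) →
    ∃[ w ] ∃[ x′ ] ∃[ y′ ] 0ℤ < w × 0ℤ < x′ × 0ℤ < y′ ×
      trib w x′ y′ (4 ℕ.+ m) ≡ trib x y z (3 ℕ.+ m)
  extend {E} x y z 0<E p≤E q≤E r≤E p-q-r≤E q+q-p≤E large
    -- `Y` and `Z` are N times the displacement from (y , z) to (1 , 3) n / N. Its coordinates in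
    -- the basis are therefore the two dividends over K = N b, and the quotients `s` and `t` are
    -- their floors.
    with floorDivision 0<K (q * Y - r * Z) | floorDivision 0<K (q * Z - p * Y)
    where
    n = trib x y z (3 ℕ.+ m)
    Y = n - N * y
    Z = + 3 * n - N * z
    0<K = *-pos 0<N 0<b
  ... | f , s , S≡ , 0≤f , f<K | g , t , T≡ , 0≤g , g<K =
    -- With this prepended term, the term following `y′` is `z′` again.
    z′ - x′ - y′ , x′ , y′ ,
    subst (0ℤ <_) (recombine p q r s t x y z) (positive′ p-q-r≤E q+q-p≤E span-w) ,
    positive′ r≤E p-q-r≤E (span-x Y Z on-plane) ,
    positive′ q≤E r≤E (span-y Y Z) ,
    trans (cong (λ e → trib x′ y′ e (3 ℕ.+ m)) (restore x′ y′ z′)) same-end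
    where
    n = trib x y z (3 ℕ.+ m)
    X = n - N * x
    Y = n - N * y
    Z = + 3 * n - N * z
    S = q * Y - r * Z
    T = q * Z - p * Y
    K = N * b
    0<K = *-pos 0<N 0<b
    x′ = x + s * r + t * (p - q - r)
    y′ = y + s * q + t * r
    z′ = z + s * p + t * q

    positive′ : ∀ {u v w} → u ≤ E → v ≤ E → b * (n - N * w) ≡ S * u + T * v → 0ℤ < w + s * u + t * v
    positive′ {u} {v} {w} u≤E v≤E spanned =
      remainder-positive {b} {n} {N} {S} {T} {f} {g} {s} {t} {u} {v} {w} {E} {K}
        refl 0<K spanned S≡ T≡ (combination-< 0≤f f<K 0≤g g<K 0<E u≤E v≤E)
        (subst (_≤ b * n) (reassociate N b (E + E)) (ℤ.*-monoˡ-≤-nonNeg b {{nonNegative (ℤ.<⇒≤ 0<b)}} large))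
      where
      reassociate : ∀ N b e → b * (N * e) ≡ N * b * e
      reassociate = solve-∀

    on-plane : b * X + (a + b) * Y + c * Z ≡ 0ℤ
    on-plane = begin
      b * X + (a + b) * Y + c * Z
        ≡⟨ collect a b c n N x y z ⟩
      n * N - N * (b * x + (a + b) * y + c * z)
        ≡⟨ cong (λ e → n * N - N * e) (sym (term₃ x y z)) ⟩
      n * N - N * n
        ≡⟨ cong (_- N * n) (ℤ.*-comm n N) ⟩
      N * n - N * n
        ≡⟨ ℤ.+-inverseʳ (N * n) ⟩
      0ℤ ∎
      where
      open ≡-Reasoning
      collect : ∀ a b c n N x y z →
        b * (n - N * x) + (a + b) * (n - N * y) + c * (+ 3 * n - N * z)
        ≡ n * (b + (a + b) + + 3 * c) - N * (b * x + (a + b) * y + c * z)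
      collect = solve-∀

    -- The functional z - x - y takes the values p - q - r and 2 q - p on the basis rows and 1 on (1
    -- , 1 , 3), so the prepended term obeys the same estimate as `x′` and `y′`.
    span-w : b * (n - N * (z - x - y)) ≡ S * (p - q - r) + T * (q + q - p)
    span-w = begin
      b * (n - N * (z - x - y))
        ≡⟨ distribute b n N x y z ⟩
      b * Z - b * X - b * Y
        ≡⟨ cong₂ _-_ (cong₂ _-_ (span-z Y Z) (span-x Y Z on-plane)) (span-y Y Z) ⟩
      S * p + T * q - (S * r + T * (p - q - r)) - (S * q + T * r)
        ≡⟨ collect p q r S T ⟩
      S * (p - q - r) + T * (q + q - p) ∎
      where
      open ≡-Reasoning
      distribute : ∀ b n N x y z → b * (n - N * (z - x - y))
        ≡ b * (+ 3 * n - N * z) - b * (n - N * x) - b * (n - N * y)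
      distribute = solve-∀
      collect : ∀ p q r S T → S * p + T * q - (S * r + T * (p - q - r)) - (S * q + T * r)
        ≡ S * (p - q - r) + T * (q + q - p)
      collect = solve-∀

    recombine : ∀ p q r s t x y z → (z - x - y) + s * (p - q - r) + t * (q + q - p)
      ≡ (z + s * p + t * q) - (x + s * r + t * (p - q - r)) - (y + s * q + t * r)
    recombine = solve-∀

    restore : ∀ x y z → y + x + (z - x - y) ≡ z
    restore = solve-∀

    same-end : trib x′ y′ z′ (3 ℕ.+ m) ≡ n
    same-end = begin
      trib x′ y′ z′ (3 ℕ.+ m)
        ≡⟨ term₃ x′ y′ z′ ⟩
      b * x′ + (a + b) * y′ + c * z′
        ≡⟨ distribute a b c x y z (s * r) (s * q) (s * p) (t * (p - q - r)) (t * r) (t * q) ⟩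
      b * x + (a + b) * y + c * z + (b * (s * r) + (a + b) * (s * q) + c * (s * p))
        + (b * (t * (p - q - r)) + (a + b) * (t * r) + c * (t * q))
        ≡⟨ cong₂ (λ i j → b * x + (a + b) * y + c * z + i + j) (plane s) (plane′ t) ⟩
      b * x + (a + b) * y + c * z + 0ℤ + 0ℤ
        ≡⟨ trans (ℤ.+-identityʳ _) (ℤ.+-identityʳ _) ⟩
      b * x + (a + b) * y + c * z
        ≡⟨ sym (term₃ x y z) ⟩
      n ∎
      where
      open ≡-Reasoning
      distribute : ∀ a b c x y z i j k i′ j′ k′ →
        b * (x + i + i′) + (a + b) * (y + j + j′) + c * (z + k + k′)
        ≡ b * x + (a + b) * y + c * z + (b * i + (a + b) * j + c * k) + (b * i′ + (a + b) * j′ + c * k′)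
      distribute = solve-∀

  -- Bounds for an inextensible sequence

  module _ {B} (bnd : Bound W B) where
    open Bound bnd

    -- Contrapositive of `extend` with E = 3 B, followed by N · 6 B ≤ 9 b · 6 B.
    end<b*radius : ∀ x y z → Inextensible m (trib x y z (3 ℕ.+ m)) →
      trib x y z (3 ℕ.+ m) < b * + radius B
    end<b*radius x y z inextensible with N * (E + E) ℤ.≤? trib x y z (3 ℕ.+ m)
      where E = + (B ℕ.+ B ℕ.+ B)
    ... | yes large = ⊥-elim (contradict (extend x y z
      (+<+ (ℕ.≤-trans 1≤B (ℕ.m≤n+m B (B ℕ.+ B))))
      (i≤3B {i = 0ℤ} {0ℤ} {p} p z≤n z≤n ∣p∣≤B ℕ.≤-refl)
      (i≤3B {i = 0ℤ} {0ℤ} {q} q z≤n z≤n ∣q∣≤B ℕ.≤-refl)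
      (i≤3B {i = 0ℤ} {0ℤ} {r} r z≤n z≤n ∣r∣≤B ℕ.≤-refl)
      (i≤3B {i = p} {q} {r} (p - q - r) ∣p∣≤B ∣q∣≤B ∣r∣≤B
        (ℕ.≤-trans (ℤ.∣i-j∣≤∣i∣+∣j∣ (p - q) r) (ℕ.+-monoˡ-≤ ∣ r ∣ (ℤ.∣i-j∣≤∣i∣+∣j∣ p q))))
      (i≤3B {i = q} {q} {p} (q + q - p) ∣q∣≤B ∣q∣≤B ∣p∣≤B
        (ℕ.≤-trans (ℤ.∣i-j∣≤∣i∣+∣j∣ (q + q) p) (ℕ.+-monoˡ-≤ ∣ p ∣ (ℤ.∣i+j∣≤∣i∣+∣j∣ q q))))
      large))
      where
      contradict : ∃[ w ] ∃[ x′ ] ∃[ y′ ] 0ℤ < w × 0ℤ < x′ × 0ℤ < y′ ×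
        trib w x′ y′ (4 ℕ.+ m) ≡ trib x y z (3 ℕ.+ m) → ⊥
      contradict (w , x′ , y′ , 0<w , 0<x′ , 0<y′ , e) = inextensible w x′ y′ 0<w 0<x′ 0<y′ e
    ... | no small = ℤ.<-≤-trans (ℤ.≰⇒> small)
      (subst (N * (E + E) ≤_) regroup (ℤ.*-monoʳ-≤-nonNeg (E + E) N≤9b))
      where
      E = + (B ℕ.+ B ℕ.+ B)
      commute : ∀ b e → + 9 * b * e ≡ b * (+ 9 * e)
      commute = solve-∀
      regroup : + 9 * b * (E + E) ≡ b * + radius B
      regroup = trans (commute b (E + E))
        (cong (b *_) (sym (ℤ.pos-* 9 ((B ℕ.+ B ℕ.+ B) ℕ.+ (B ℕ.+ B ℕ.+ B)))))

    -- Since a + b ≥ b and the other summands are non-negative, b y is at most the last term. The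
    -- argument for z uses c ≥ b.
    y<radius : ∀ {x y z} → 0ℤ < x → 0ℤ < y → 0ℤ < z → Inextensible m (trib x y z (3 ℕ.+ m)) → y < + radius B
    y<radius {x} {y} {z} 0<x 0<y 0<z inextensible = <-cancelˡ 0<b (ℤ.≤-<-trans
      (≤-by-difference (trans (cong (_- b * y) (term₃ x y z)) (split a b c x y z))
        (+-nonNeg (+-nonNeg (nonNeg (ℤ.<⇒≤ 0<b) 0<x) (nonNeg 0≤a 0<y)) (nonNeg (ℤ.<⇒≤ (0<c W)) 0<z)))
      (end<b*radius x y z inextensible))
      where
      nonNeg : ∀ {i j} → 0ℤ ≤ i → 0ℤ < j → 0ℤ ≤ i * j
      nonNeg 0≤i 0<j = *-nonNeg 0≤i (ℤ.<⇒≤ 0<j)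
      split : ∀ a b c x y z → b * x + (a + b) * y + c * z - b * y ≡ b * x + a * y + c * z
      split = solve-∀

    z<radius : ∀ {x y z} → 0ℤ < x → 0ℤ < y → 0ℤ < z → Inextensible m (trib x y z (3 ℕ.+ m)) → z < + radius B
    z<radius {x} {y} {z} 0<x 0<y 0<z inextensible = <-cancelˡ 0<b (ℤ.≤-<-trans
      (≤-by-difference (trans (cong (_- b * z) (term₃ x y z)) (split a b c x y z))
        (+-nonNeg (+-nonNeg (nonNeg (ℤ.<⇒≤ 0<b) 0<x) (nonNeg (+-nonNeg 0≤a (ℤ.<⇒≤ 0<b)) 0<y))
                  (nonNeg (ℤ.i≤j⇒0≤j-i (b≤c W)) 0<z)))
      (end<b*radius x y z inextensible))
      where
      nonNeg : ∀ {i j} → 0ℤ ≤ i → 0ℤ < j → 0ℤ ≤ i * j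
      nonNeg 0≤i 0<j = *-nonNeg 0≤i (ℤ.<⇒≤ 0<j)
      split : ∀ a b c x y z → b * x + (a + b) * y + c * z - b * z ≡ b * x + (a + b) * y + (c - b) * z
      split = solve-∀

    -- 432 = 2 · 54 · 4, from radius B = 54 B and B² ≤ 4 b.
    quotient-bound : ∀ i j Y Z {d} → b * d ≡ i * Z - j * Y → ∣ i ∣ ℕ.≤ B → ∣ j ∣ ℕ.≤ B →
      ∣ Y ∣ ℕ.≤ radius B → ∣ Z ∣ ℕ.≤ radius B → ∣ d ∣ ℕ.≤ 432
    quotient-bound i j Y Z {d} eq i≤B j≤B Y≤M Z≤M =
      ℕ.*-cancelˡ-≤ ∣ b ∣ {{ℕ.>-nonZero 0<∣b∣}} (begin
        ∣ b ∣ ℕ.* ∣ d ∣                        ≡⟨ ℤ.abs-* b d ⟨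
        ∣ b * d ∣                              ≡⟨ cong ∣_∣ eq ⟩
        ∣ i * Z - j * Y ∣                      ≤⟨ ℤ.∣i-j∣≤∣i∣+∣j∣ (i * Z) (j * Y) ⟩
        ∣ i * Z ∣ ℕ.+ ∣ j * Y ∣                ≡⟨ cong₂ ℕ._+_ (ℤ.abs-* i Z) (ℤ.abs-* j Y) ⟩
        ∣ i ∣ ℕ.* ∣ Z ∣ ℕ.+ ∣ j ∣ ℕ.* ∣ Y ∣    ≤⟨ ℕ.+-mono-≤ (ℕ.*-mono-≤ i≤B Z≤M) (ℕ.*-mono-≤ j≤B Y≤M) ⟩
        B ℕ.* radius B ℕ.+ B ℕ.* radius B      ≡⟨ collect B ⟩
        108 ℕ.* (B ℕ.* B)                      ≤⟨ ℕ.*-monoʳ-≤ 108 B*B≤4∣b∣ ⟩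
        108 ℕ.* (4 ℕ.* ∣ b ∣)                  ≡⟨ ℕ.*-assoc 108 4 ∣ b ∣ ⟨
        432 ℕ.* ∣ b ∣                          ≡⟨ ℕ.*-comm 432 ∣ b ∣ ⟩
        ∣ b ∣ ℕ.* 432                          ∎)
      where
      open ℕ.≤-Reasoning
      collect : ∀ B → B ℕ.* (9 ℕ.* ((B ℕ.+ B ℕ.+ B) ℕ.+ (B ℕ.+ B ℕ.+ B)))
        ℕ.+ B ℕ.* (9 ℕ.* ((B ℕ.+ B ℕ.+ B) ℕ.+ (B ℕ.+ B ℕ.+ B))) ≡ 108 ℕ.* (B ℕ.* B)
      collect = ℕ-Solver.solve-∀
      +∣b∣≡b : + ∣ b ∣ ≡ b
      +∣b∣≡b = ℤ.0≤i⇒+∣i∣≡i (ℤ.<⇒≤ 0<b)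
      0<∣b∣ : 0 ℕ.< ∣ b ∣
      0<∣b∣ = ℤ.drop‿+<+ (subst (0ℤ <_) (sym +∣b∣≡b) 0<b)
      B*B≤4∣b∣ : B ℕ.* B ℕ.≤ 4 ℕ.* ∣ b ∣
      B*B≤4∣b∣ = ℤ.drop‿+≤+ (subst₂ _≤_ (sym (ℤ.pos-* B B))
        (trans (cong (+ 4 *_) (sym +∣b∣≡b)) (sym (ℤ.pos-* 4 ∣ b ∣))) B²≤4b)

  -- Eliminating x between this term and the last one leaves 2 × 2 minors of their coefficient rows,
  -- which the window identifies as r and q; for `term₂-eliminated` they are q and p.
  term₀-eliminated : ∀ x y z → b * trib x y z m ≡ (b + b - c) * trib x y z (3 ℕ.+ m) + (r * z - q * y)
  term₀-eliminated x y z = begin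
    b * trib x y z m
      ≡⟨ cong (b *_) (term₀ x y z) ⟩
    b * ((b + b - c) * x + (a + a + b - c) * y + (c - a - b) * z)
      ≡⟨ expand a b c x y z ⟩
    (b + b - c) * (b * x + (a + b) * y + c * z) + ((c * c - b * c - a * b - b * b) * z - (b * b - a * c) * y)
      ≡⟨ cong₂ (λ i e → (b + b - c) * i + e) (sym (term₃ x y z))
           (cong₂ (λ i j → i * z - j * y) (sym r-minor) (sym q-minor)) ⟩
    (b + b - c) * trib x y z (3 ℕ.+ m) + (r * z - q * y) ∎
    where
    open ≡-Reasoning
    expand : ∀ a b c x y z → b * ((b + b - c) * x + (a + a + b - c) * y + (c - a - b) * z)
      ≡ (b + b - c) * (b * x + (a + b) * y + c * z) + ((c * c - b * c - a * b - b * b) * z - (b * b - a * c) * y)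
    expand = solve-∀

  term₂-eliminated : ∀ x y z → b * trib x y z (2 ℕ.+ m) ≡ a * trib x y z (3 ℕ.+ m) + (q * z - p * y)
  term₂-eliminated x y z = begin
    b * trib x y z (2 ℕ.+ m)
      ≡⟨ cong (b *_) (term₂ x y z) ⟩
    b * (a * x + (c - b) * y + b * z)
      ≡⟨ expand a b c x y z ⟩
    a * (b * x + (a + b) * y + c * z) + ((b * b - a * c) * z - (a * (a + b) - b * (c - b)) * y)
      ≡⟨ cong₂ (λ i e → a * i + e) (sym (term₃ x y z))
           (cong₂ (λ i j → i * z - j * y) (sym q-minor) (sym p-minor)) ⟩
    a * trib x y z (3 ℕ.+ m) + (q * z - p * y) ∎
    where
    open ≡-Reasoning
    expand : ∀ a b c x y z → b * (a * x + (c - b) * y + b * z)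
      ≡ a * (b * x + (a + b) * y + c * z) + ((b * b - a * c) * z - (a * (a + b) - b * (c - b)) * y)
    expand = solve-∀

difference-eliminated : ∀ b k i j n {u u′} y z y′ z′ →
  b * u ≡ k * n + (i * z - j * y) → b * u′ ≡ k * n + (i * z′ - j * y′) →
  b * (u - u′) ≡ i * (z - z′) - j * (y - y′)
difference-eliminated b k i j n {u} {u′} y z y′ z′ e e′ =
  trans (distribute b u u′) (trans (cong₂ _-_ e e′) (cancel k n i j y z y′ z′))
  where
  distribute : ∀ b u u′ → b * (u - u′) ≡ b * u - b * u′
  distribute = solve-∀
  cancel : ∀ k n i j y z y′ z′ →
    k * n + (i * z - j * y) - (k * n + (i * z′ - j * y′)) ≡ i * (z - z′) - j * (y - y′)
  cancel = solve-∀

-- Counting solutions by residues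

record Solution (n : ℤ) (m : ℕ) (x y z : ℤ) : Set where
  field
    0<x : 0ℤ < x
    0<y : 0ℤ < y
    0<z : 0ℤ < z
    end : trib x y z (3 ℕ.+ m) ≡ n

-- Values that pairwise differ by at most 432 are separated by their residues modulo 749, and two
-- residues give 749² = 561001 codes.
residue : ℤ → Fin 749
residue i = Fin.fromℕ< (n%ℕd<d i 749)

residues-determine : ∀ {i j} → residue i ≡ residue j → ∣ i - j ∣ ℕ.≤ 432 → i ≡ j
residues-determine {i} {j} eq close = residue-injective 749
  (Fin.fromℕ<-injective (i %ℕ 749) (j %ℕ 749) (n%ℕd<d i 749) (n%ℕd<d j 749) eq)
  (ℕ.≤-<-trans close (ℕ.m≤m+n 433 316))

module _ {n : ℤ} (m : ℕ) (inextensible : Inextensible m n) where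
  open Window (window m)

  -- The residues fix the terms of index m and 2 + m, and n is the term of index 3 + m. The
  -- recurrence then yields the term of index 1 + m, and three consecutive terms determine the
  -- start.
  solution-determined : ∀ {x y z x′ y′ z′} → Solution n m x y z → Solution n m x′ y′ z′ →
    residue (trib x y z m) ≡ residue (trib x′ y′ z′ m) →
    residue (trib x y z (2 ℕ.+ m)) ≡ residue (trib x′ y′ z′ (2 ℕ.+ m)) →
    x ≡ x′ × y ≡ y′ × z ≡ z′
  solution-determined {x} {y} {z} {x′} {y′} {z′} σ σ′ e₀ e₂ =
    trib-determined m same₀
      (+-cancelˡ (trib x y z (2 ℕ.+ m)) _ _
        (trans (isolate x y z) (trans (cong₂ _-_ ends same₀)
          (trans (sym (isolate x′ y′ z′)) (cong (_+ trib x′ y′ z′ (1 ℕ.+ m)) (sym same₂))))))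
      same₂
    where
    W = window m
    module σ = Solution σ
    module σ′ = Solution σ′
    bnd = proj₂ (bound W)
    open Bound bnd
    ends : trib x y z (3 ℕ.+ m) ≡ trib x′ y′ z′ (3 ℕ.+ m)
    ends = trans σ.end (sym σ′.end)
    inext : ∀ {x y z} → Solution n m x y z → Inextensible m (trib x y z (3 ℕ.+ m))
    inext τ = subst (Inextensible m) (sym (Solution.end τ)) inextensible
    y-close : ∣ y - y′ ∣ ℕ.≤ radius (proj₁ (bound W))
    y-close = ∣i-j∣≤bound
      σ.0<y (y<radius W bnd σ.0<x σ.0<y σ.0<z (inext σ))
      σ′.0<y (y<radius W bnd σ′.0<x σ′.0<y σ′.0<z (inext σ′))
    z-close : ∣ z - z′ ∣ ℕ.≤ radius (proj₁ (bound W))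
    z-close = ∣i-j∣≤bound
      σ.0<z (z<radius W bnd σ.0<x σ.0<y σ.0<z (inext σ))
      σ′.0<z (z<radius W bnd σ′.0<x σ′.0<y σ′.0<z (inext σ′))
    same₀ : trib x y z m ≡ trib x′ y′ z′ m
    same₀ = residues-determine e₀ (quotient-bound W bnd r q (y - y′) (z - z′)
      (difference-eliminated b (b + b - c) r q (trib x y z (3 ℕ.+ m)) y z y′ z′
        (term₀-eliminated W x y z)
        (trans (term₀-eliminated W x′ y′ z′) (cong (λ e → (b + b - c) * e + (r * z′ - q * y′)) (sym ends))))
      ∣r∣≤B ∣q∣≤B y-close z-close)
    same₂ : trib x y z (2 ℕ.+ m) ≡ trib x′ y′ z′ (2 ℕ.+ m)
    same₂ = residues-determine e₂ (quotient-bound W bnd q p (y - y′) (z - z′)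
      (difference-eliminated b a q p (trib x y z (3 ℕ.+ m)) y z y′ z′
        (term₂-eliminated W x y z)
        (trans (term₂-eliminated W x′ y′ z′) (cong (λ e → a * e + (q * z′ - p * y′)) (sym ends))))
      ∣q∣≤B ∣p∣≤B y-close z-close)
    isolate : ∀ x y z → trib x y z (2 ℕ.+ m) + trib x y z (1 ℕ.+ m) ≡ trib x y z (3 ℕ.+ m) - trib x y z m
    isolate x y z = trans (cancel (trib x y z (2 ℕ.+ m)) (trib x y z (1 ℕ.+ m)) (trib x y z m))
      (cong (_- trib x y z m) (sym (trib-rec x y z m)))
      where
      cancel : ∀ i j k → i + j ≡ i + j + k - k
      cancel = solve-∀

-- From vectors to the final count

code₀ code₂ : ∀ m → Vec ℤ (4 ℕ.+ m) → Fin 749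
code₀ m (x ∷ y ∷ z ∷ _) = residue (trib x y z m)
code₂ m (x ∷ y ∷ z ∷ _) = residue (trib x y z (2 ℕ.+ m))

toSolution : ∀ {n} m {x y z} {v : Vec ℤ (1 ℕ.+ m)} →
  PositiveTribonacci n (4 ℕ.+ m) (x ∷ y ∷ z ∷ v) → Solution n m x y z
toSolution m {x} {y} {z} {v} pt = record
  { 0<x = pt.positive Fin.zero (s≤s z≤n)
  ; 0<y = pt.positive (Fin.suc Fin.zero) (s≤s (s≤s z≤n))
  ; 0<z = pt.positive (Fin.suc (Fin.suc Fin.zero)) (s≤s (s≤s (s≤s z≤n)))
  ; end = end pt.terminates
  }
  where
  module pt = PositiveTribonacci pt
  end : TerminatesAt _ (x ∷ y ∷ z ∷ v) → trib x y z (3 ℕ.+ m) ≡ _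
  end (i , i≡last , e) = trans (cong (trib x y z) (sym (ℕ.suc-injective i≡last)))
    (trans (sym (lookup-trib x y z v pt.tribonacci i)) e)

tribonacci-determined : ∀ {j x y z x′ y′ z′} {u v : Vec ℤ j} →
  IsTribonacci (x ∷ y ∷ z ∷ u) → IsTribonacci (x′ ∷ y′ ∷ z′ ∷ v) →
  x ≡ x′ × y ≡ y′ × z ≡ z′ → x ∷ y ∷ z ∷ u ≡ x′ ∷ y′ ∷ z′ ∷ v
tribonacci-determined {x = x} {y} {z} {u = u} {v} tu tv (refl , refl , refl) = begin
  x ∷ y ∷ z ∷ u                           ≡⟨ tabulate∘lookup (x ∷ y ∷ z ∷ u) ⟨
  tabulate (lookup (x ∷ y ∷ z ∷ u))       ≡⟨ tabulate-cong same ⟩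
  tabulate (lookup (x ∷ y ∷ z ∷ v))       ≡⟨ tabulate∘lookup (x ∷ y ∷ z ∷ v) ⟩
  x ∷ y ∷ z ∷ v                           ∎
  where
  open ≡-Reasoning
  same : ∀ i → lookup (x ∷ y ∷ z ∷ u) i ≡ lookup (x ∷ y ∷ z ∷ v) i
  same i = trans (lookup-trib x y z u tu i) (sym (lookup-trib x y z v tv i))

codes-injective : ∀ {n} m → Inextensible m n → ∀ {u v} →
  PositiveTribonacci n (4 ℕ.+ m) u → PositiveTribonacci n (4 ℕ.+ m) v →
  code₀ m u ≡ code₀ m v → code₂ m u ≡ code₂ m v → u ≡ v
codes-injective m inextensible {x ∷ y ∷ z ∷ u} {x′ ∷ y′ ∷ z′ ∷ v} pu pv e₀ e₂ =
  tribonacci-determined (PositiveTribonacci.tribonacci pu) (PositiveTribonacci.tribonacci pv)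
    (solution-determined m inextensible (toSolution m pu) (toSolution m pv) e₀ e₂)

Unique-lookup-injective : ∀ {A : Set} {xs : List A} → Unique xs →
  ∀ {i j} → List.lookup xs i ≡ List.lookup xs j → i ≡ j
Unique-lookup-injective (_ ∷ _) {Fin.zero} {Fin.zero} _ = refl
Unique-lookup-injective {xs = _ ∷ xs} (x∉xs ∷ _) {Fin.zero} {Fin.suc j} e = ⊥-elim (All.lookup x∉xs (∈-lookup j) e)
Unique-lookup-injective {xs = _ ∷ xs} (x∉xs ∷ _) {Fin.suc i} {Fin.zero} e = ⊥-elim (All.lookup x∉xs (∈-lookup i) (sym e))
Unique-lookup-injective (_ ∷ u) {Fin.suc i} {Fin.suc j} e = cong Fin.suc (Unique-lookup-injective u e)

-- Pigeonhole: `combine` packs the two codes into one element of `Fin (M * N)`, so list positions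
-- inject into that type.
atMost-injective : ∀ {A : Set} {P : A → Set} {M N} (f : A → Fin M) (g : A → Fin N) →
  (∀ {x y} → P x → P y → f x ≡ f y → g x ≡ g y → x ≡ y) → AtMost (M ℕ.* N) P
atMost-injective f g injective xs unique all =
  Fin.injective⇒≤ {f = λ i → combine (f (List.lookup xs i)) (g (List.lookup xs i))} λ {i} {j} e →
    let f≡ , g≡ = Fin.combine-injective _ _ _ _ e in
    Unique-lookup-injective unique
      (injective (All.lookup all (∈-lookup i)) (All.lookup all (∈-lookup j)) f≡ g≡)

largest⇒inextensible : ∀ {n} m → IsLargestLength n (4 ℕ.+ m) → Inextensible m n
largest⇒inextensible m largest w x y 0<w 0<x 0<y e =
  ℕ.1+n≰n (IsLargestLength.maximal largest (5 ℕ.+ m) (_ , tribVec-solution (4 ℕ.+ m) 0<w 0<x 0<y e))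

-- The sequence n - 2, 1, 1, n has length 4 and is positive because n ≥ 3. This justifies writing
-- the largest length as 4 + m.
4≤largest : ∀ {n k} → + 3 ≤ n → IsLargestLength n k → 4 ℕ.≤ k
4≤largest {n} 3≤n largest = IsLargestLength.maximal largest 4
  (_ , tribVec-solution 3 {n - + 2} {1ℤ} {1ℤ} (i<j⇒0<j-i (ℤ.<-≤-trans (+<+ (s≤s (s≤s (s≤s z≤n)))) 3≤n))
    (+<+ (s≤s z≤n)) (+<+ (s≤s z≤n)) (restore n))
  where
  restore : ∀ n → + 2 + (n - + 2) ≡ n
  restore = solve-∀

theorem1 : ∀ (n : ℤ) → + 3 ≤ n → ∀ (k : ℕ) → IsLargestLength n k →
    AtMost 561001 (PositiveTribonacci n k)
theorem1 n 3≤n k largest with ℕ.m≤n⇒∃[o]m+o≡n (4≤largest 3≤n largest)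
-- The product 749 · 749 evaluates to 561001.
... | m , refl = atMost-injective (code₀ m) (code₂ m) (codes-injective m (largest⇒inextensible m largest))
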